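{- Let $p=q=1/2$, let $X_{n,s}$ be the number of turns required to end the single-player pile game with boundary with set of choices $R=\{1,-1\}$ and target $n$, starting with $s$ chips, $0\le s\le n$, and let $\mu_{n,s}=E[X_{n,s}]$. Then $$\mathrm{Var}[X_{n,s}]=E[(X_{n,s}-\mu_{n,s})^2]=\frac{(n-s)(n+s+1)(2n^2+2n+2s^2+2s-1)}{3},$$ $$E[(X_{n,s}-\mu_{n,s})^3]=\frac{(n-s)(n+s+1)}{15}\Bigl(16n^4+32n^3+8n^2(2s^2+2s+1)+8n(2s^2+2s-1)+16s^4+32s^3+8s^2-8s-3\Bigr).$$
   Context: Single-player pile game with boundary, $R=\{1,-1\}$: the player starts with $s$ chips, $0\le s\le n$. In each turn, independently, with probability $p$ one chip is added, and with probability $q=1-p$ one chip is removed, except that if the player has $0$ chips he stays at $0$ instead. The game ends when the player first has $n$ chips (at turn $0$ if $s=n$). -}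

module Defs where

open import Algebra.Definitions.RawSemiring using (_^_)
open import Data.Bool.Base using (Bool; not; _∧_)
import Data.Integer.Base as ℤ
open import Data.List.Base using (List; []; _∷_; _++_; map; filterᵇ; foldr)
open import Data.Nat.Base as ℕ using (ℕ; zero; suc; _≡ᵇ_)
open import Data.Product.Base using (∃)
open import Data.Rational.Base
  using (ℚ; 0ℚ; 1ℚ; _+_; _*_; _-_; _/_; _≤_; _<_; ∣_∣; +-*-rawSemiring)
open import Data.Vec.Base using (Vec; []; _∷_)

infixr 8 _^ℚ_
_^ℚ_ : ℚ → ℕ → ℚ
_^ℚ_ = _^_ +-*-rawSemiring

ℕ→ℚ : ℕ → ℚ
ℕ→ℚ k = ℤ.+ k / 1

-- The set of choices R = {1, -1}.
data Choice : Set where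
  add remove : Choice

move : Choice → ℕ → ℕ
move add    s       = suc s
move remove zero    = zero
move remove (suc s) = s

-- Started with s chips, a game following the given choices reaches n chips
-- for the first time exactly after the last of them.
endsᵇ : ℕ → ℕ → ∀ {k} → Vec Choice k → Bool
endsᵇ n s []      = s ≡ᵇ n
endsᵇ n s (c ∷ w) = not (s ≡ᵇ n) ∧ endsᵇ n (move c s) w

choices : ∀ k → List (Vec Choice k)
choices zero    = [] ∷ []
choices (suc k) = map (add ∷_) (choices k) ++ map (remove ∷_) (choices k)

-- Probability of one choice, and of an initial run of independent choices,
-- when a chip is added with probability p and removed with probability 1 - p.
choiceProb : ℚ → Choice → ℚ
choiceProb p add    = p
choiceProb p remove = 1ℚ - p

runProb : ℚ → ∀ {k} → Vec Choice k → ℚ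
runProb p []      = 1ℚ
runProb p (c ∷ w) = choiceProb p c * runProb p w

-- Probability of an event determined by the first k choices.
Pr : ℚ → ∀ k → (Vec Choice k → Bool) → ℚ
Pr p k A = foldr _+_ 0ℚ (map (runProb p) (filterᵇ A (choices k)))

-- Distribution of the number of turns X: the value at k is P(X = k).
turns : ℚ → ℕ → ℕ → ℕ → ℚ
turns p n s k = Pr p k (endsᵇ n s)

partialSum : (ℕ → ℚ) → ℕ → ℚ
partialSum a zero    = 0ℚ
partialSum a (suc K) = partialSum a K + a K

SumsTo : (ℕ → ℚ) → ℚ → Set
SumsTo a v = ∀ ε → 0ℚ < ε → ∃ λ N → ∀ K → N ℕ.≤ K → ∣ partialSum a K - v ∣ < ε

-- E[f(X)] exists and equals v, where P(X = k) = P k. The first field says that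
-- X is finite almost surely; the second is absolute convergence, stated as
-- boundedness of the partial sums because their limit is a real number that
-- need not be rational.
record HasExpectation (P : ℕ → ℚ) (f : ℕ → ℚ) (v : ℚ) : Set where
  field
    total      : SumsTo P 1ℚ
    integrable : ∃ λ B → ∀ K → partialSum (λ k → ∣ f k ∣ * P k) K ≤ B
    value      : SumsTo (λ k → f k * P k) v

-- SumsTo determines its limit, so at most one μ satisfies HasMean P μ.
HasMean : (ℕ → ℚ) → ℚ → Set
HasMean P μ = HasExpectation P ℕ→ℚ μ

-- E[(X - μ)ʳ] = v; for r = 2 and μ the mean, this is Var[X] = v.
HasMomentAbout : ℚ → ℕ → (ℕ → ℚ) → ℚ → Set
HasMomentAbout μ r P v = HasExpectation P (λ k → (ℕ→ℚ k - μ) ^ℚ r) v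

{-# OPTIONS --safe #-}

-- Write u = s(s+1) and a = n(n+1). A turn changes u by 2s+2 or -2s with probability ½ each,
-- and this remains true at the boundary s = 0, so polynomials in u need no boundary case.
-- Let t = k + (a - u) - μ. One checks that, for suitable polynomials φ₂ and φ₃,
--   t + μ,   t² + (φ₂(a) - φ₂(u)),   t³ + 3t(φ₂(a) - φ₂(u)) + (φ₃(a) - φ₃(u))
-- are martingales in the number of turns k; at s = n they equal k, (k - μ)², (k - μ)³, and at
-- k = 0 with μ = a - u they are the mean and the two central moments. Optional stopping
-- applies because the contribution of the games still alive after k turns tends to 0:
-- b(b+1)(b+2)(b+3)(1 + a - u), with b = 1 + k + 4a, is a supermartingale, hence the
-- survival probability is O(k⁻⁴), while the martingales above are O(k³).

module Submission where

open import Defs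

module _ where

  open import Algebra.Bundles using (CommutativeRing)
  open import Data.Bool.Base using (Bool; true; false; not; _∧_; if_then_else_; T)
  open import Data.Integer.Base as ℤ using (ℤ; +_)
  import Data.Integer.Properties as ℤ
  open import Data.List.Base using (List; []; _∷_; _++_; map; filterᵇ; foldr)
  open import Data.List.Properties using (filter-++; map-++)
  open import Data.Nat.Base as ℕ using (ℕ; zero; suc; _≡ᵇ_)
  import Data.Nat.Coprimality as Coprime
  import Data.Nat.Properties as ℕ
  open import Data.Product using (∃; _×_; _,_)
  open import Data.Rational
  open import Data.Rational.Properties
  open import Data.Rational.Solver using (module +-*-Solver)
  import Data.Rational.Unnormalised as ℚᵘ
  import Data.Rational.Unnormalised.Properties as ℚᵘ
  open import Data.Sum.Base using (inj₁; inj₂)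
  open import Data.Vec.Base using (Vec; _∷_)
  open import Function.Base using (_∘_; id)
  open import Relation.Binary.PropositionalEquality
  open import Relation.Nullary using (contradiction)
  open import Relation.Nullary.Decidable using (T?)
  open import Algebra.Properties.Semiring.Exp
    (CommutativeRing.semiring +-*-commutativeRing) using (^-homo-*)
  open +-*-Solver using (Polynomial; solve; con; _:=_; _:+_; _:*_; _:-_; :-_; _:^_)

  -- Order in the rationals.

  *-mono-≤-nonNeg : ∀ {p q r t} → 0ℚ ≤ p → p ≤ q → 0ℚ ≤ r → r ≤ t → p * r ≤ q * t
  *-mono-≤-nonNeg {p} {q} {r} {t} 0≤p p≤q 0≤r r≤t = ≤-trans
    (*-monoʳ-≤-nonNeg r {{nonNegative 0≤r}} p≤q)
    (*-monoˡ-≤-nonNeg q {{nonNegative (≤-trans 0≤p p≤q)}} r≤t)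

  0≤p*q : ∀ {p q} → 0ℚ ≤ p → 0ℚ ≤ q → 0ℚ ≤ p * q
  0≤p*q {p} {q} 0≤p 0≤q =
    nonNegative⁻¹ _ {{nonNeg*nonNeg⇒nonNeg p {{nonNegative 0≤p}} q {{nonNegative 0≤q}}}}

  p≤p+q : ∀ {p q} → 0ℚ ≤ q → p ≤ p + q
  p≤p+q {p} 0≤q = ≤-trans (≤-reflexive (sym (+-identityʳ p))) (+-monoʳ-≤ p 0≤q)

  0≤p+q : ∀ {p q} → 0ℚ ≤ p → 0ℚ ≤ q → 0ℚ ≤ p + q
  0≤p+q 0≤p 0≤q = ≤-trans 0≤p (p≤p+q 0≤q)

  -- Embedding the integers into the rationals; the Archimedean property.

  fromℚᵘ-homo-+ : ∀ p q → fromℚᵘ (p ℚᵘ.+ q) ≡ fromℚᵘ p + fromℚᵘ q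
  fromℚᵘ-homo-+ p q = toℚᵘ-injective (begin
    toℚᵘ (fromℚᵘ (p ℚᵘ.+ q))                ≈⟨ toℚᵘ-fromℚᵘ (p ℚᵘ.+ q) ⟩
    p ℚᵘ.+ q                                ≈⟨ ℚᵘ.+-cong (toℚᵘ-fromℚᵘ p) (toℚᵘ-fromℚᵘ q) ⟨
    toℚᵘ (fromℚᵘ p) ℚᵘ.+ toℚᵘ (fromℚᵘ q)    ≈⟨ toℚᵘ-homo-+ (fromℚᵘ p) (fromℚᵘ q) ⟨
    toℚᵘ (fromℚᵘ p + fromℚᵘ q)              ∎)
    where open import Relation.Binary.Reasoning.Setoid ℚᵘ.≃-setoid

  fromℚᵘ-homo-* : ∀ p q → fromℚᵘ (p ℚᵘ.* q) ≡ fromℚᵘ p * fromℚᵘ q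
  fromℚᵘ-homo-* p q = toℚᵘ-injective (begin
    toℚᵘ (fromℚᵘ (p ℚᵘ.* q))                ≈⟨ toℚᵘ-fromℚᵘ (p ℚᵘ.* q) ⟩
    p ℚᵘ.* q                                ≈⟨ ℚᵘ.*-cong (toℚᵘ-fromℚᵘ p) (toℚᵘ-fromℚᵘ q) ⟨
    toℚᵘ (fromℚᵘ p) ℚᵘ.* toℚᵘ (fromℚᵘ q)    ≈⟨ toℚᵘ-homo-* (fromℚᵘ p) (fromℚᵘ q) ⟨
    toℚᵘ (fromℚᵘ p * fromℚᵘ q)              ∎)
    where open import Relation.Binary.Reasoning.Setoid ℚᵘ.≃-setoid

  fromℚᵘ-homo‿- : ∀ p → fromℚᵘ (ℚᵘ.- p) ≡ - fromℚᵘ p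
  fromℚᵘ-homo‿- p = toℚᵘ-injective (begin
    toℚᵘ (fromℚᵘ (ℚᵘ.- p))    ≈⟨ toℚᵘ-fromℚᵘ (ℚᵘ.- p) ⟩
    ℚᵘ.- p                    ≈⟨ ℚᵘ.-‿cong (toℚᵘ-fromℚᵘ p) ⟨
    ℚᵘ.- toℚᵘ (fromℚᵘ p)      ≈⟨ toℚᵘ-homo‿- (fromℚᵘ p) ⟨
    toℚᵘ (- fromℚᵘ p)         ∎)
    where open import Relation.Binary.Reasoning.Setoid ℚᵘ.≃-setoid

  /1-homo-+ : ∀ i j → (i ℤ.+ j) / 1 ≡ i / 1 + j / 1
  /1-homo-+ i j = trans
    (cong (_/ 1) (sym (cong₂ ℤ._+_ (ℤ.*-identityʳ i) (ℤ.*-identityʳ j))))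
    (fromℚᵘ-homo-+ (ℚᵘ.mkℚᵘ i 0) (ℚᵘ.mkℚᵘ j 0))

  /1-homo-* : ∀ i j → (i ℤ.* j) / 1 ≡ i / 1 * (j / 1)
  /1-homo-* i j = fromℚᵘ-homo-* (ℚᵘ.mkℚᵘ i 0) (ℚᵘ.mkℚᵘ j 0)

  /1-homo-- : ∀ i j → (i ℤ.- j) / 1 ≡ i / 1 - j / 1
  /1-homo-- i j = trans (/1-homo-+ i (ℤ.- j))
    (cong₂ _+_ {x = i / 1} refl (fromℚᵘ-homo‿- (ℚᵘ.mkℚᵘ j 0)))

  /1-homo-^ : ∀ i r → (i ℤ.^ r) / 1 ≡ (i / 1) ^ℚ r
  /1-homo-^ i zero    = refl
  /1-homo-^ i (suc r) = trans (/1-homo-* i (i ℤ.^ r)) (cong ((i / 1) *_) (/1-homo-^ i r))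

  i/d≡i/1*1/d : ∀ i d .{{_ : ℕ.NonZero d}} → i / d ≡ i / 1 * (+ 1 / d)
  i/d≡i/1*1/d i (suc d) = trans
    -- The unnormalised product of `i / 1` and `1 / suc d` has numerator `i * 1` and denominator
    -- `suc (d + 0)`.
    (cong₂ (λ j e → fromℚᵘ (ℚᵘ.mkℚᵘ j e)) (sym (ℤ.*-identityʳ i)) (sym (ℕ.+-identityʳ d)))
    (fromℚᵘ-homo-* (ℚᵘ.mkℚᵘ i 0) (ℚᵘ.mkℚᵘ (+ 1) d))

  ℕ→ℚ-suc : ∀ k → ℕ→ℚ (suc k) ≡ 1ℚ + ℕ→ℚ k
  ℕ→ℚ-suc k = /1-homo-+ (+ 1) (+ k)

  0≤ℕ→ℚ : ∀ k → 0ℚ ≤ ℕ→ℚ k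
  0≤ℕ→ℚ k = nonNegative⁻¹ _ {{normalize-nonNeg k 1}}

  ℕ→ℚ-mono : ∀ {k l} → k ℕ.≤ l → ℕ→ℚ k ≤ ℕ→ℚ l
  ℕ→ℚ-mono {k} {l} k≤l = subst (ℕ→ℚ k ≤_)
    (trans (sym (/1-homo-+ (+ k) (+ (l ℕ.∸ k)))) (cong ℕ→ℚ (ℕ.m+[n∸m]≡n k≤l)))
    (p≤p+q (0≤ℕ→ℚ (l ℕ.∸ k)))

  -- A fraction is at most the absolute value of its numerator, because its denominator is at least
  -- 1; adding one makes the bound strict.
  ∃-ℕ→ℚ> : ∀ q → ∃ λ N → q < ℕ→ℚ N
  ∃-ℕ→ℚ> q@(mkℚ i d-1 _) = N , subst (q <_) (sym (normalize-coprime 1-coprime)) (*<* i*1<N*d)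
    where
    N = suc ℤ.∣ i ∣
    d = suc d-1
    1-coprime = Coprime.sym (Coprime.1-coprimeTo N)
    i≤∣i∣ : ∀ j → j ℤ.≤ + ℤ.∣ j ∣
    i≤∣i∣ (+ _)      = ℤ.≤-refl
    i≤∣i∣ ℤ.-[1+ _ ] = ℤ.-≤+
    i*1<N*d : i ℤ.* + 1 ℤ.< + N ℤ.* + d
    i*1<N*d = begin-strict
      i ℤ.* + 1       ≡⟨ ℤ.*-identityʳ i ⟩
      i               ≤⟨ i≤∣i∣ i ⟩
      + ℤ.∣ i ∣       <⟨ ℤ.+<+ (ℕ.n<1+n _) ⟩
      + N             ≤⟨ ℤ.+≤+ (ℕ.m≤m*n N d) ⟩
      + (N ℕ.* d)     ≡⟨ ℤ.pos-* N d ⟩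
      + N ℤ.* + d     ∎
      where open ℤ.≤-Reasoning

  archimedean : ∀ q {ε} → 0ℚ < ε → ∃ λ N → q < ℕ→ℚ N * ε
  archimedean q {ε} 0<ε = let N , q/ε<N = ∃-ℕ→ℚ> (q * 1/ ε) in
    N , <-respˡ-≡ q/ε*ε≡q (*-monoˡ-<-pos ε {{positive 0<ε}} q/ε<N)
    where
    instance ε≢0 = >-nonZero 0<ε
    q/ε*ε≡q : q * 1/ ε * ε ≡ q
    q/ε*ε≡q = trans (*-assoc q (1/ ε) ε) (trans (cong (q *_) (*-inverseˡ ε)) (*-identityʳ q))

  -- Probabilities of runs, split by the first choice.

  foldr-+-++ : ∀ xs ys → foldr _+_ 0ℚ (xs ++ ys) ≡ foldr _+_ 0ℚ xs + foldr _+_ 0ℚ ys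
  foldr-+-++ []       ys = sym (+-identityˡ _)
  foldr-+-++ (x ∷ xs) ys = trans (cong (λ z → x + z) (foldr-+-++ xs ys)) (sym (+-assoc x _ _))

  module _ (p : ℚ) where

    -- This is `Pr` with an arbitrary list in place of `choices k`, which allows induction on the
    -- list.
    weight : ∀ {k} → (Vec Choice k → Bool) → List (Vec Choice k) → ℚ
    weight A ws = foldr _+_ 0ℚ (map (runProb p) (filterᵇ A ws))

    weight-++ : ∀ {k} A (us ws : List (Vec Choice k)) →
                weight A (us ++ ws) ≡ weight A us + weight A ws
    weight-++ A us ws = trans
      (cong (λ vs → foldr _+_ 0ℚ (map (runProb p) vs)) (filter-++ (T? ∘ A) us ws))
      (trans (cong (foldr _+_ 0ℚ) (map-++ (runProb p) (filterᵇ A us) (filterᵇ A ws)))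
             (foldr-+-++ (map (runProb p) (filterᵇ A us)) (map (runProb p) (filterᵇ A ws))))

    weight-map : ∀ {k} A c (ws : List (Vec Choice k)) →
                 weight A (map (c ∷_) ws) ≡ choiceProb p c * weight (A ∘ (c ∷_)) ws
    weight-map A c []       = sym (*-zeroʳ (choiceProb p c))
    weight-map A c (w ∷ ws) with A (c ∷ w)
    ... | false = weight-map A c ws
    ... | true  = trans (cong (λ z → choiceProb p c * runProb p w + z) (weight-map A c ws))
                        (sym (*-distribˡ-+ (choiceProb p c) _ _))

    weight-false : ∀ {k} (ws : List (Vec Choice k)) → weight (λ _ → false) ws ≡ 0ℚ
    weight-false []       = refl
    weight-false (_ ∷ ws) = weight-false ws

    -- First-step analysis: `choices (suc k)` groups the runs by their first choice, whose
    -- probability factors out of each group.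
    Pr-suc : ∀ k A → Pr p (suc k) A ≡
             p * Pr p k (A ∘ (add ∷_)) + (1ℚ - p) * Pr p k (A ∘ (remove ∷_))
    Pr-suc k A = trans (weight-++ A (map (add ∷_) (choices k)) (map (remove ∷_) (choices k)))
      (cong₂ _+_ (weight-map A add (choices k)) (weight-map A remove (choices k)))

  -- The stopped walk and optional stopping.

  avg : (ℕ → ℚ) → ℕ → ℚ
  avg h s = ½ * h (move add s) + ½ * h (move remove s)

  avg-mono : ∀ h h′ s → h (move add s) ≤ h′ (move add s) →
             h (move remove s) ≤ h′ (move remove s) → avg h s ≤ avg h′ s
  avg-mono h h′ s p q = +-mono-≤ (*-monoˡ-≤-nonNeg ½ p) (*-monoˡ-≤-nonNeg ½ q)

  ∣avg∣≤avg : ∀ g h s → ∣ g (move add s) ∣ ≤ h (move add s) →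
              ∣ g (move remove s) ∣ ≤ h (move remove s) → ∣ avg g s ∣ ≤ avg h s
  ∣avg∣≤avg g h s p q = begin
    ∣ avg g s ∣
      ≤⟨ ∣p+q∣≤∣p∣+∣q∣ (½ * g (move add s)) (½ * g (move remove s)) ⟩
    ∣ ½ * g (move add s) ∣ + ∣ ½ * g (move remove s) ∣
      ≡⟨ cong₂ _+_ (∣p*q∣≡∣p∣*∣q∣ ½ (g (move add s))) (∣p*q∣≡∣p∣*∣q∣ ½ (g (move remove s))) ⟩
    avg (λ s′ → ∣ g s′ ∣) s
      ≤⟨ avg-mono (λ s′ → ∣ g s′ ∣) h s p q ⟩
    avg h s ∎
    where open ≤-Reasoning

  module _ (n : ℕ) where

    -- One turn from s, where c is the value of stopping at n.
    step : ℚ → (ℕ → ℚ) → ℕ → ℚ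
    step c h s = if s ≡ᵇ n then c else avg h s

    -- Since `P` receives the whole operator at `s`, one case distinction reduces every occurrence
    -- of `step` in a goal at once, even with different arguments `c` and `h`.
    step-elim : ∀ s (P : (ℚ → (ℕ → ℚ) → ℚ) → Set) → (s ≡ n → P (λ c _ → c)) →
                (s ≢ n → P (λ _ h → avg h s)) → P (λ c h → step c h s)
    step-elim s P stop go with s ≡ᵇ n in eq
    ... | true  = stop (ℕ.≡ᵇ⇒≡ s n (subst T (sym eq) _))
    ... | false = go (λ s≡n → subst T eq (ℕ.≡⇒≡ᵇ s n s≡n))

    -- A game that starts at `n` is over at turn 0, so no run of positive length ends it: hence the
    -- stopping value `0ℚ`. Otherwise the first choice is averaged out.
    turns-suc : ∀ k s → turns ½ n s (suc k) ≡ step 0ℚ (λ s′ → turns ½ n s′ k) s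
    turns-suc k s = trans (Pr-suc ½ k (endsᵇ n s)) (lemma (s ≡ᵇ n))
      where
      lemma : ∀ b → ½ * Pr ½ k (λ w → not b ∧ endsᵇ n (move add s) w)
                    + (1ℚ - ½) * Pr ½ k (λ w → not b ∧ endsᵇ n (move remove s) w)
              ≡ (if b then 0ℚ else avg (λ s′ → turns ½ n s′ k) s)
      lemma true  = cong₂ (λ x y → ½ * x + ½ * y)
        (weight-false ½ (choices k)) (weight-false ½ (choices k))
      -- Holds by computation, as `1ℚ - ½` evaluates to `½`.
      lemma false = refl

    -- E[h(S_K); X ≥ K], where S_K is the number of chips after K turns from s.
    survive : ℕ → (ℕ → ℚ) → ℕ → ℚ
    survive zero    h = h
    survive (suc K) h = step 0ℚ (survive K h)

    -- Among the games with X ≥ K, those at `n` after K turns have X = K and receive `c`; the others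
    -- take one more turn.
    survive-step : ∀ K c h s →
                   survive K (step c h) s ≡ c * turns ½ n s K + survive (suc K) h s
    survive-step zero c h s with s ≡ᵇ n
    ... | true  = solve 1 (λ c → c := c :* con 1ℚ :+ con 0ℚ) refl c
    ... | false = solve 2 (λ c a → a := c :* con 0ℚ :+ a) refl c (avg h s)
    survive-step (suc K) c h s rewrite turns-suc K s with s ≡ᵇ n
    ... | true  = solve 1 (λ c → con 0ℚ := c :* con 0ℚ :+ con 0ℚ) refl c
    ... | false = trans
      (cong₂ (λ x y → ½ * x + ½ * y)
        (survive-step K c h (move add s)) (survive-step K c h (move remove s)))
      (solve 5 (λ c a a′ b b′ →
          con ½ :* (c :* a :+ b) :+ con ½ :* (c :* a′ :+ b′)
          := c :* (con ½ :* a :+ con ½ :* a′) :+ (con ½ :* b :+ con ½ :* b′))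
        refl c (turns ½ n (move add s) K) (turns ½ n (move remove s) K)
        (survive (suc K) h (move add s)) (survive (suc K) h (move remove s)))

    survive-* : ∀ K c h s → survive K (λ s′ → c * h s′) s ≡ c * survive K h s
    survive-* zero    c h s = refl
    survive-* (suc K) c h s with s ≡ᵇ n
    ... | true  = sym (*-zeroʳ c)
    ... | false = trans
      (cong₂ (λ x y → ½ * x + ½ * y) (survive-* K c h (move add s)) (survive-* K c h (move remove s)))
      (solve 3 (λ c a b → con ½ :* (c :* a) :+ con ½ :* (c :* b) := c :* (con ½ :* a :+ con ½ :* b))
        refl c (survive K h (move add s)) (survive K h (move remove s)))

    move-remove-≤ : ∀ {s} → s ℕ.≤ n → move remove s ℕ.≤ n
    move-remove-≤ {zero}  s≤n = s≤n
    move-remove-≤ {suc s} s<n = ℕ.<⇒≤ s<n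

    -- Comparison on the states up to `n` suffices: a turn is only taken from s < n, so the walk
    -- never leaves this range.
    survive-mono : ∀ K {h h′} → (∀ {s} → s ℕ.≤ n → h s ≤ h′ s) →
                   ∀ {s} → s ℕ.≤ n → survive K h s ≤ survive K h′ s
    survive-mono zero    h≤h′     s≤n = h≤h′ s≤n
    survive-mono (suc K) {h} {h′} h≤h′ {s} s≤n = 
      step-elim s (λ S → S 0ℚ (survive K h) ≤ S 0ℚ (survive K h′)) (λ _ → ≤-refl) λ s≢n →
      avg-mono (survive K h) (survive K h′) s (survive-mono K {h} {h′} h≤h′ (ℕ.≤∧≢⇒< s≤n s≢n))
                 (survive-mono K {h} {h′} h≤h′ (move-remove-≤ s≤n))

    survive-cong : ∀ K {h h′} → (∀ {s} → s ℕ.≤ n → h s ≡ h′ s) →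
                   ∀ {s} → s ℕ.≤ n → survive K h s ≡ survive K h′ s
    survive-cong K {h} {h′} h≡h′ s≤n = ≤-antisym
      (survive-mono K {h} {h′} (≤-reflexive ∘ h≡h′) s≤n)
      (survive-mono K {h′} {h} (≤-reflexive ∘ sym ∘ h≡h′) s≤n)

    ∣survive∣≤survive : ∀ K {g h} → (∀ {s} → s ℕ.≤ n → ∣ g s ∣ ≤ h s) →
                        ∀ {s} → s ℕ.≤ n → ∣ survive K g s ∣ ≤ survive K h s
    ∣survive∣≤survive zero    ∣g∣≤h     s≤n = ∣g∣≤h s≤n
    ∣survive∣≤survive (suc K) {g} {h} ∣g∣≤h {s} s≤n =
      step-elim s (λ S → ∣ S 0ℚ (survive K g) ∣ ≤ S 0ℚ (survive K h)) (λ _ → ≤-refl) λ s≢n →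
      ∣avg∣≤avg (survive K g) (survive K h) s (∣survive∣≤survive K {g} {h} ∣g∣≤h (ℕ.≤∧≢⇒< s≤n s≢n))
                  (∣survive∣≤survive K {g} {h} ∣g∣≤h (move-remove-≤ s≤n))

    -- Φ k s stands for the conditional expectation of f(X) given X ≥ k and S_k = s.
    Martingale Supermartingale : (ℕ → ℚ) → (ℕ → ℕ → ℚ) → Set
    Martingale      f Φ = ∀ k {s} → s ℕ.≤ n → step (f k) (Φ (suc k)) s ≡ Φ k s
    Supermartingale f Φ = ∀ k {s} → s ℕ.≤ n → step (f k) (Φ (suc k)) s ≤ Φ k s

    stopped-sum-suc : ∀ (f : ℕ → ℚ) (Φ : ℕ → ℕ → ℚ) K s →
      partialSum (λ k → f k * turns ½ n s k) (suc K) + survive (suc K) (Φ (suc K)) s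
      ≡ partialSum (λ k → f k * turns ½ n s k) K + survive K (step (f K) (Φ (suc K))) s
    stopped-sum-suc f Φ K s = trans
      (+-assoc (partialSum (λ k → f k * turns ½ n s k) K) (f K * turns ½ n s K) _)
      (cong (λ z → partialSum (λ k → f k * turns ½ n s k) K + z)
            (sym (survive-step K (f K) (Φ (suc K)) s)))

    -- The left side does not depend on `K`: the newest term of the sum is absorbed into the
    -- survivors as the stopping value of a `step`, which the martingale property then undoes.
    optional-stopping : ∀ {f Φ} → Martingale f Φ → ∀ K {s} → s ℕ.≤ n →
      partialSum (λ k → f k * turns ½ n s k) K + survive K (Φ K) s ≡ Φ 0 s
    optional-stopping             _ zero    _   = +-identityˡ _
    optional-stopping {f} {Φ} m (suc K) {s} s≤n = begin
      Σf (suc K) + survive (suc K) (Φ (suc K)) s            ≡⟨ stopped-sum-suc f Φ K s ⟩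
      Σf K + survive K (step (f K) (Φ (suc K))) s
        ≡⟨ cong (λ z → Σf K + z) (survive-cong K {step (f K) (Φ (suc K))} {Φ K} (m K) s≤n) ⟩
      Σf K + survive K (Φ K) s                              ≡⟨ optional-stopping {f} {Φ} m K s≤n ⟩
      Φ 0 s                                                 ∎
      where
      open ≡-Reasoning
      Σf = partialSum (λ k → f k * turns ½ n s k)

    optional-stopping-≤ : ∀ {f Φ} → Supermartingale f Φ → ∀ K {s} → s ℕ.≤ n →
      partialSum (λ k → f k * turns ½ n s k) K + survive K (Φ K) s ≤ Φ 0 s
    optional-stopping-≤         _ zero    _   = ≤-reflexive (+-identityˡ _)
    optional-stopping-≤ {f} {Φ} m (suc K) {s} s≤n = begin
      Σf (suc K) + survive (suc K) (Φ (suc K)) s            ≡⟨ stopped-sum-suc f Φ K s ⟩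
      Σf K + survive K (step (f K) (Φ (suc K))) s
        ≤⟨ +-monoʳ-≤ (Σf K) (survive-mono K {step (f K) (Φ (suc K))} {Φ K} (m K) s≤n) ⟩
      Σf K + survive K (Φ K) s                              ≤⟨ optional-stopping-≤ {f} {Φ} m K s≤n ⟩
      Φ 0 s                                                 ∎
      where
      open ≤-Reasoning
      Σf = partialSum (λ k → f k * turns ½ n s k)

  -- Partial sums.

  partialSum-cong : ∀ {a b} → (∀ k → a k ≡ b k) → ∀ K → partialSum a K ≡ partialSum b K
  partialSum-cong a≡b zero    = refl
  partialSum-cong a≡b (suc K) = cong₂ _+_ (partialSum-cong a≡b K) (a≡b K)

  partialSum-0 : ∀ {a} → (∀ k → a k ≡ 0ℚ) → ∀ K → partialSum a K ≡ 0ℚ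
  partialSum-0 a≡0 zero    = refl
  partialSum-0 a≡0 (suc K) = cong₂ _+_ (partialSum-0 a≡0 K) (a≡0 K)

  partialSum-nonNeg : ∀ {a} → (∀ k → 0ℚ ≤ a k) → ∀ K → 0ℚ ≤ partialSum a K
  partialSum-nonNeg 0≤a zero    = ≤-refl
  partialSum-nonNeg 0≤a (suc K) = 0≤p+q (partialSum-nonNeg 0≤a K) (0≤a K)

  term≤partialSum : ∀ {a} → (∀ k → 0ℚ ≤ a k) → ∀ {k K} → k ℕ.< K → a k ≤ partialSum a K
  term≤partialSum {a} 0≤a {k} {suc K} (ℕ.s≤s k≤K) with ℕ.m≤n⇒m<n∨m≡n k≤K
  ... | inj₁ k<K  = ≤-trans (term≤partialSum 0≤a k<K) (p≤p+q (0≤a K))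
  ... | inj₂ refl = ≤-trans (p≤p+q (partialSum-nonNeg 0≤a k)) (≤-reflexive (+-comm (a k) (partialSum a k)))

  -- The products s(s+1) along the walk.

  oblong : ℕ → ℚ
  oblong s = ℕ→ℚ s * (1ℚ + ℕ→ℚ s)

  0≤oblong : ∀ s → 0ℚ ≤ oblong s
  0≤oblong s = 0≤p*q (0≤ℕ→ℚ s) (0≤p+q (nonNegative⁻¹ 1ℚ) (0≤ℕ→ℚ s))

  oblong-mono : ∀ {s t} → s ℕ.≤ t → oblong s ≤ oblong t
  oblong-mono {s} s≤t = *-mono-≤-nonNeg (0≤ℕ→ℚ s) (ℕ→ℚ-mono s≤t)
    (0≤p+q (nonNegative⁻¹ 1ℚ) (0≤ℕ→ℚ s)) (+-monoʳ-≤ 1ℚ (ℕ→ℚ-mono s≤t))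

  oblong-add : ∀ s → oblong (move add s) ≡ (1ℚ + ℕ→ℚ s) * (1ℚ + (1ℚ + ℕ→ℚ s))
  oblong-add s = cong (λ x → x * (1ℚ + x)) (ℕ→ℚ-suc s)

  -- This includes the boundary s = 0, because s(s+1) takes the same value at -1 and 0.
  oblong-remove : ∀ s → oblong (move remove s) ≡ (ℕ→ℚ s - 1ℚ) * ℕ→ℚ s
  oblong-remove zero    = refl
  oblong-remove (suc s) = trans
    (solve 1 (λ x → x :* (con 1ℚ :+ x) := (con 1ℚ :+ x :- con 1ℚ) :* (con 1ℚ :+ x)) refl (ℕ→ℚ s))
    (cong (λ x → (x - 1ℚ) * x) (sym (ℕ→ℚ-suc s)))

  avg-oblong : ∀ (F : ℚ → ℚ) s → let x = ℕ→ℚ s in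
    avg (λ s′ → F (oblong s′)) s
    ≡ ½ * F ((1ℚ + x) * (1ℚ + (1ℚ + x))) + ½ * F ((x - 1ℚ) * x)
  avg-oblong F s = cong₂ (λ u v → ½ * F u + ½ * F v) (oblong-add s) (oblong-remove s)

  -- A quartic supermartingale.

  4ℚ : ℚ
  4ℚ = + 4 / 1

  -- The rising factorial b(b+1)(b+2)(b+3) replaces the power b⁴ because its values at b and b + 1
  -- share the factor (b+1)(b+2)(b+3), leaving only b against b + 4.
  quartic : ℚ → ℚ
  quartic b = b * ((1ℚ + b) * (1ℚ + (1ℚ + b)) * (1ℚ + (1ℚ + (1ℚ + b))))

  0≤cubic : ∀ {b} → 0ℚ ≤ b → 0ℚ ≤ (1ℚ + b) * (1ℚ + (1ℚ + b)) * (1ℚ + (1ℚ + (1ℚ + b)))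
  0≤cubic {b} 0≤b = 0≤p*q (0≤p*q 0≤1+b 0≤2+b) (0≤p+q 0≤1 0≤2+b)
    where
    0≤1 = nonNegative⁻¹ 1ℚ
    0≤1+b = 0≤p+q 0≤1 0≤b
    0≤2+b = 0≤p+q 0≤1 0≤1+b

  b*b³≤quartic : ∀ {b} → 0ℚ ≤ b → b * b ^ℚ 3 ≤ quartic b
  b*b³≤quartic {b} 0≤b = begin
    b * b ^ℚ 3
      -- The rising factorial expands to b⁴ + 6b³ + 11b² + 6b.
      ≤⟨ p≤p+q (0≤p*q 0≤b (0≤p+q (0≤p+q (0≤p*q (0≤p*q 0≤6 0≤b) 0≤b) (0≤p*q 0≤11 0≤b)) 0≤6)) ⟩
    b * b ^ℚ 3 + b * (6ℚ * b * b + 11ℚ * b + 6ℚ)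
      ≡⟨ solve 1 (λ b → b :* (b :* (b :* (b :* con 1ℚ))) :+ b :* (con 6ℚ :* b :* b :+ con 11ℚ :* b :+ con 6ℚ)
                     := b :* ((con 1ℚ :+ b) :* (con 1ℚ :+ (con 1ℚ :+ b)) :* (con 1ℚ :+ (con 1ℚ :+ (con 1ℚ :+ b)))))
               refl b ⟩
    quartic b ∎
    where
    open ≤-Reasoning
    6ℚ 11ℚ : ℚ
    6ℚ = + 6 / 1
    11ℚ = + 11 / 1
    0≤6 = nonNegative⁻¹ 6ℚ
    0≤11 = nonNegative⁻¹ 11ℚ

  -- Without the shared cubic factor this reads (b + 4)(a - u) + (1 + κ + 4u) = b(1 + (a - u)),
  -- which is true because b = 1 + κ + 4a.
  quartic-decrease : ∀ κ a u → let b = 1ℚ + κ + 4ℚ * a in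
    quartic (1ℚ + b) * (a - u)
      + (1ℚ + b) * (1ℚ + (1ℚ + b)) * (1ℚ + (1ℚ + (1ℚ + b))) * (1ℚ + κ + 4ℚ * u)
    ≡ quartic b * (1ℚ + (a - u))
  quartic-decrease κ a u = solve 3 (λ κ a u →
    let i = con 1ℚ
        b = i :+ κ :+ con 4ℚ :* a
        cubic = λ b → (i :+ b) :* (i :+ (i :+ b)) :* (i :+ (i :+ (i :+ b)))
    in (i :+ b) :* cubic (i :+ b) :* (a :- u) :+ cubic b :* (i :+ κ :+ con 4ℚ :* u)
       := b :* cubic b :* (i :+ (a :- u))) refl κ a u

  module _ (n : ℕ) where

    -- The shift by 4n(n+1) is what makes the remainder 1 + κ + 4u in `quartic-decrease`
    -- nonnegative; the summand 1 keeps the level at least k + 1.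
    level : ℕ → ℚ
    level k = 1ℚ + ℕ→ℚ k + 4ℚ * oblong n

    level-suc : ∀ k → level (suc k) ≡ 1ℚ + level k
    level-suc k = trans (cong (λ κ → 1ℚ + κ + 4ℚ * oblong n) (ℕ→ℚ-suc k))
      (solve 2 (λ κ a → con 1ℚ :+ (con 1ℚ :+ κ) :+ a := con 1ℚ :+ (con 1ℚ :+ κ :+ a)) refl
        (ℕ→ℚ k) (4ℚ * oblong n))

    0≤4*oblong : ∀ s → 0ℚ ≤ 4ℚ * oblong s
    0≤4*oblong s = 0≤p*q (nonNegative⁻¹ 4ℚ) (0≤oblong s)

    1+k≤level : ∀ k → ℕ→ℚ (suc k) ≤ level k
    1+k≤level k = ≤-trans (≤-reflexive (ℕ→ℚ-suc k)) (p≤p+q (0≤4*oblong n))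

    1≤1+k : ∀ k → 1ℚ ≤ ℕ→ℚ (suc k)
    1≤1+k k = ℕ→ℚ-mono {1} {suc k} (ℕ.s≤s ℕ.z≤n)

    1≤level : ∀ k → 1ℚ ≤ level k
    1≤level k = ≤-trans (1≤1+k k) (1+k≤level k)

    0≤level : ∀ k → 0ℚ ≤ level k
    0≤level k = ≤-trans (nonNegative⁻¹ 1ℚ) (1≤level k)

    0≤quartic-level : ∀ k → 0ℚ ≤ quartic (level k)
    0≤quartic-level k = 0≤p*q (0≤level k) (0≤cubic (0≤level k))

    -- A turn multiplies quartic by (b + 4)/b, where b = level k ≥ 4n(n+1), and lowers the
    -- average of the last factor, which is at most 1 + n(n+1), by 1; so the product decreases.
    barrier : ℚ → ℕ → ℕ → ℚ
    barrier C k s = C * (quartic (level k) * (1ℚ + (oblong n - oblong s)))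

    quartic≤barrier : ∀ {C} → 0ℚ ≤ C → ∀ k {s} → s ℕ.≤ n → C * quartic (level k) ≤ barrier C k s
    quartic≤barrier {C} 0≤C k {s} s≤n = *-monoˡ-≤-nonNeg C {{nonNegative 0≤C}} (begin
      quartic (level k)           ≡⟨ *-identityʳ _ ⟨
      quartic (level k) * 1ℚ
        ≤⟨ *-monoˡ-≤-nonNeg (quartic (level k)) {{nonNegative (0≤quartic-level k)}} (p≤p+q 0≤gap) ⟩
      quartic (level k) * (1ℚ + (oblong n - oblong s)) ∎)
      where
      open ≤-Reasoning
      0≤gap : 0ℚ ≤ oblong n - oblong s
      0≤gap = ≤-trans (≤-reflexive (sym (+-inverseʳ (oblong s)))) (+-monoˡ-≤ (- oblong s) (oblong-mono s≤n))

    -- A turn raises the average of `oblong` by exactly 1, which cancels the `1ℚ` in the last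
    -- factor.
    avg-barrier : ∀ C k s →
      avg (barrier C (suc k)) s ≡ C * (quartic (1ℚ + level k) * (oblong n - oblong s))
    avg-barrier C k s = begin
      avg (barrier C (suc k)) s
        ≡⟨ avg-oblong (λ u → C * (quartic (level (suc k)) * (1ℚ + (oblong n - u)))) s ⟩
      _
        ≡⟨ solve 4 (λ c w a x → let i = con 1ℚ in
             con ½ :* (c :* (w :* (i :+ (a :- (i :+ x) :* (i :+ (i :+ x))))))
             :+ con ½ :* (c :* (w :* (i :+ (a :- (x :- i) :* x))))
             := c :* (w :* (a :- x :* (i :+ x)))) refl C (quartic (level (suc k))) (oblong n) (ℕ→ℚ s) ⟩
      C * (quartic (level (suc k)) * (oblong n - oblong s))
        ≡⟨ cong (λ b → C * (quartic b * (oblong n - oblong s))) (level-suc k) ⟩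
      C * (quartic (1ℚ + level k) * (oblong n - oblong s)) ∎
      where open ≡-Reasoning

    -- Used with two payoffs: payoff 0 bounds the survivors, and payoff ∣f∣ bounds the partial sums
    -- for absolute convergence.
    barrier-supermartingale : ∀ {C f} → 0ℚ ≤ C → (∀ k → f k ≤ C * quartic (level k)) →
                              Supermartingale n f (barrier C)
    barrier-supermartingale {C} {f} 0≤C f≤ k {s} s≤n =
      step-elim n s (λ S → S (f k) (barrier C (suc k)) ≤ barrier C k s)
        (λ _ → ≤-trans (f≤ k) (quartic≤barrier 0≤C k s≤n)) λ _ → begin
      avg (barrier C (suc k)) s
        ≡⟨ avg-barrier C k s ⟩
      C * (quartic (1ℚ + level k) * (oblong n - oblong s))
        -- The inserted nonnegative term is the remainder in `quartic-decrease`.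
        ≤⟨ *-monoˡ-≤-nonNeg C {{nonNegative 0≤C}} (p≤p+q
             (0≤p*q (0≤cubic (0≤level k)) (0≤p+q (0≤p+q (nonNegative⁻¹ 1ℚ) (0≤ℕ→ℚ k)) (0≤4*oblong s)))) ⟩
      C * (quartic (1ℚ + level k) * (oblong n - oblong s) + _)
        ≡⟨ cong (C *_) (quartic-decrease (ℕ→ℚ k) (oblong n) (oblong s)) ⟩
      barrier C k s ∎
      where open ≤-Reasoning

  -- Polynomial growth in time and convergence of expectations.

  module _ (n : ℕ) where

    -- Growth of degree `d` in time, uniform over the states up to `n`. It is measured in `level`
    -- rather than in k because `level` is at least 1, so lower degrees are absorbed by higher ones.
    record Growth (d : ℕ) (F : ℕ → ℕ → ℚ) : Set where
      constructor growth
      field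
        constant   : ℚ
        0≤constant : 0ℚ ≤ constant
        bound      : ∀ k {s} → s ℕ.≤ n → ∣ F k s ∣ ≤ constant * level n k ^ℚ d

    0≤level^ : ∀ k d → 0ℚ ≤ level n k ^ℚ d
    0≤level^ k zero    = nonNegative⁻¹ 1ℚ
    0≤level^ k (suc d) = 0≤p*q (0≤level n k) (0≤level^ k d)

    growth-time : Growth 1 (λ k _ → ℕ→ℚ k)
    growth-time = growth 1ℚ (nonNegative⁻¹ 1ℚ) λ k _ → begin
      ∣ ℕ→ℚ k ∣                ≡⟨ 0≤p⇒∣p∣≡p (0≤ℕ→ℚ k) ⟩
      ℕ→ℚ k                    ≤⟨ ℕ→ℚ-mono {k} {suc k} (ℕ.n≤1+n k) ⟩
      ℕ→ℚ (suc k)              ≤⟨ 1+k≤level n k ⟩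
      level n k                ≡⟨ trans (*-identityˡ (level n k ^ℚ 1)) (*-identityʳ (level n k)) ⟨
      1ℚ * level n k ^ℚ 1      ∎
      where open ≤-Reasoning

    -- There are only finitely many states up to `n`, so the sum of all ∣φ∣ over them serves as the
    -- bound.
    growth-state : ∀ (φ : ℕ → ℚ) → Growth 0 (λ _ s → φ s)
    growth-state φ = growth (partialSum ∣φ∣ (suc n)) (partialSum-nonNeg 0≤∣φ∣ (suc n)) λ _ {s} s≤n →
      ≤-trans (term≤partialSum 0≤∣φ∣ (ℕ.s≤s s≤n)) (≤-reflexive (sym (*-identityʳ _)))
      where
      ∣φ∣ = λ s → ∣ φ s ∣
      0≤∣φ∣ = λ s → 0≤∣p∣ (φ s)

    growth-weaken : ∀ {d F} → Growth d F → Growth (suc d) F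
    growth-weaken {d} (growth C 0≤C F≤) = growth C 0≤C λ k s≤n → ≤-trans (F≤ k s≤n)
      (*-monoˡ-≤-nonNeg C {{nonNegative 0≤C}} (≤-trans
        (≤-reflexive (sym (*-identityˡ (level n k ^ℚ d))))
        (*-monoʳ-≤-nonNeg (level n k ^ℚ d) {{nonNegative (0≤level^ k d)}} (1≤level n k))))

    growth-+ : ∀ {d F G} → Growth d F → Growth d G → Growth d (λ k s → F k s + G k s)
    growth-+ {d} {F} {G} (growth C 0≤C F≤) (growth D 0≤D G≤) =
      growth (C + D) (0≤p+q 0≤C 0≤D) λ k {s} s≤n → begin
      ∣ F k s + G k s ∣                            ≤⟨ ∣p+q∣≤∣p∣+∣q∣ (F k s) (G k s) ⟩
      ∣ F k s ∣ + ∣ G k s ∣                        ≤⟨ +-mono-≤ (F≤ k s≤n) (G≤ k s≤n) ⟩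
      C * level n k ^ℚ d + D * level n k ^ℚ d      ≡⟨ *-distribʳ-+ (level n k ^ℚ d) C D ⟨
      (C + D) * level n k ^ℚ d                     ∎
      where open ≤-Reasoning

    growth-* : ∀ {d e F G} → Growth d F → Growth e G → Growth (d ℕ.+ e) (λ k s → F k s * G k s)
    growth-* {d} {e} {F} {G} (growth C 0≤C F≤) (growth D 0≤D G≤) =
      growth (C * D) (0≤p*q 0≤C 0≤D) λ k {s} s≤n → begin
      ∣ F k s * G k s ∣
        ≡⟨ ∣p*q∣≡∣p∣*∣q∣ (F k s) (G k s) ⟩
      ∣ F k s ∣ * ∣ G k s ∣
        ≤⟨ *-mono-≤-nonNeg (0≤∣p∣ (F k s)) (F≤ k s≤n) (0≤∣p∣ (G k s)) (G≤ k s≤n) ⟩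
      C * level n k ^ℚ d * (D * level n k ^ℚ e)
        ≡⟨ solve 4 (λ c x d y → c :* x :* (d :* y) := c :* d :* (x :* y)) refl
             C (level n k ^ℚ d) D (level n k ^ℚ e) ⟩
      C * D * (level n k ^ℚ d * level n k ^ℚ e)
        ≡⟨ cong (C * D *_) (^-homo-* (level n k) d e) ⟨
      C * D * level n k ^ℚ (d ℕ.+ e) ∎
      where open ≤-Reasoning

    -- Degree 3 lies one degree below `quartic`; the spare factor k + 1 becomes the decay rate in
    -- `tail-bound`.
    growth⇒quartic : ∀ {F} (γ : Growth 3 F) → ∀ k {s} → s ℕ.≤ n →
                     ℕ→ℚ (suc k) * ∣ F k s ∣ ≤ Growth.constant γ * quartic (level n k)
    growth⇒quartic {F} (growth C 0≤C F≤) k {s} s≤n = begin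
      ℕ→ℚ (suc k) * ∣ F k s ∣
        ≤⟨ *-mono-≤-nonNeg (0≤ℕ→ℚ (suc k)) (1+k≤level n k) (0≤∣p∣ (F k s)) (F≤ k s≤n) ⟩
      level n k * (C * level n k ^ℚ 3)
        ≡⟨ solve 3 (λ b c x → b :* (c :* x) := c :* (b :* x)) refl (level n k) C (level n k ^ℚ 3) ⟩
      C * (level n k * level n k ^ℚ 3)
        ≤⟨ *-monoˡ-≤-nonNeg C {{nonNegative 0≤C}} (b*b³≤quartic (0≤level n k)) ⟩
      C * quartic (level n k)                  ∎
      where open ≤-Reasoning

    module _ {f g} (m : Martingale n f g) (γ : Growth 3 g) {s} (s≤n : s ℕ.≤ n) where

      private
        C   = Growth.constant γ
        0≤C = Growth.0≤constant γ
        Σf  = partialSum (λ k → f k * turns ½ n s k)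

      -- The factor K + 1 is moved inside `survive`, where the barrier dominates the product; a
      -- supermartingale keeps the barrier of the survivors below its initial value. Hence the
      -- survivors contribute O(1/(K + 1)).
      tail-bound : ∀ K → ℕ→ℚ (suc K) * ∣ survive n K (g K) s ∣ ≤ barrier n C 0 s
      tail-bound K = begin
        ℕ→ℚ (suc K) * ∣ survive n K (g K) s ∣
          ≡⟨ cong (_* ∣ survive n K (g K) s ∣) (0≤p⇒∣p∣≡p (0≤ℕ→ℚ (suc K))) ⟨
        ∣ ℕ→ℚ (suc K) ∣ * ∣ survive n K (g K) s ∣
          ≡⟨ ∣p*q∣≡∣p∣*∣q∣ (ℕ→ℚ (suc K)) (survive n K (g K) s) ⟨
        ∣ ℕ→ℚ (suc K) * survive n K (g K) s ∣
          ≡⟨ cong ∣_∣ (survive-* n K (ℕ→ℚ (suc K)) (g K) s) ⟨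
        ∣ survive n K (λ s′ → ℕ→ℚ (suc K) * g K s′) s ∣
          ≤⟨ ∣survive∣≤survive n K {λ s′ → ℕ→ℚ (suc K) * g K s′} {barrier n C K} scaled≤barrier s≤n ⟩
        survive n K (barrier n C K) s
          -- A vanishing sum is added to match optional stopping with payoff 0.
          ≡⟨ trans (cong (_+ survive n K (barrier n C K) s) (partialSum-0 (λ k → *-zeroˡ (turns ½ n s k)) K))
                   (+-identityˡ _) ⟨
        partialSum (λ k → 0ℚ * turns ½ n s k) K + survive n K (barrier n C K) s
          ≤⟨ optional-stopping-≤ n (barrier-supermartingale n 0≤C (λ k → 0≤p*q 0≤C (0≤quartic-level n k))) K s≤n ⟩
        barrier n C 0 s ∎
        where
        open ≤-Reasoning
        scaled≤barrier : ∀ {s′} → s′ ℕ.≤ n → ∣ ℕ→ℚ (suc K) * g K s′ ∣ ≤ barrier n C K s′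
        scaled≤barrier {s′} s′≤n = begin
          ∣ ℕ→ℚ (suc K) * g K s′ ∣        ≡⟨ ∣p*q∣≡∣p∣*∣q∣ (ℕ→ℚ (suc K)) (g K s′) ⟩
          ∣ ℕ→ℚ (suc K) ∣ * ∣ g K s′ ∣    ≡⟨ cong (_* ∣ g K s′ ∣) (0≤p⇒∣p∣≡p (0≤ℕ→ℚ (suc K))) ⟩
          ℕ→ℚ (suc K) * ∣ g K s′ ∣        ≤⟨ growth⇒quartic γ K s′≤n ⟩
          C * quartic (level n K)         ≤⟨ quartic≤barrier n 0≤C K s′≤n ⟩
          barrier n C K s′                ∎

      martingale⇒SumsTo : SumsTo (λ k → f k * turns ½ n s k) (g 0 s)
      -- N is chosen with N ε above the bound of `tail-bound`; for K ≥ N the error times K + 1 is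
      -- then below (K + 1) ε, and K + 1 cancels.
      martingale⇒SumsTo ε 0<ε = let N , bound<Nε = archimedean (barrier n C 0 s) 0<ε in N , λ K N≤K →
        *-cancelˡ-<-nonNeg (ℕ→ℚ (suc K)) {{nonNegative (0≤ℕ→ℚ (suc K))}} (begin-strict
          ℕ→ℚ (suc K) * ∣ Σf K - g 0 s ∣              ≡⟨ cong (λ v → ℕ→ℚ (suc K) * ∣ v ∣) (Σf-error K) ⟩
          ℕ→ℚ (suc K) * ∣ - survive n K (g K) s ∣     ≡⟨ cong (ℕ→ℚ (suc K) *_) (∣-p∣≡∣p∣ (survive n K (g K) s)) ⟩
          ℕ→ℚ (suc K) * ∣ survive n K (g K) s ∣       ≤⟨ tail-bound K ⟩
          barrier n C 0 s                             <⟨ bound<Nε ⟩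
          ℕ→ℚ N * ε
            ≤⟨ *-monoʳ-≤-nonNeg ε {{nonNegative (<⇒≤ 0<ε)}} (ℕ→ℚ-mono {N} {suc K} (ℕ.m≤n⇒m≤1+n N≤K)) ⟩
          ℕ→ℚ (suc K) * ε                             ∎)
        where
        open ≤-Reasoning
        Σf-error : ∀ K → Σf K - g 0 s ≡ - survive n K (g K) s
        Σf-error K = trans (cong (λ v → Σf K - v) (sym (optional-stopping n m K s≤n)))
          (solve 2 (λ x y → x :- (x :+ y) := :- y) refl (Σf K) (survive n K (g K) s))

      martingale⇒integrable : ∃ λ B → ∀ K → partialSum (λ k → ∣ f k ∣ * turns ½ n s k) K ≤ B
      martingale⇒integrable = barrier n C 0 s , λ K → ≤-trans (p≤p+q (0≤survive K))
        (optional-stopping-≤ n (barrier-supermartingale n 0≤C ∣f∣≤quartic) K s≤n)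
        where
        open ≤-Reasoning
        0≤survive : ∀ K → 0ℚ ≤ survive n K (barrier n C K) s
        0≤survive K = ≤-trans (0≤∣p∣ (survive n K (λ _ → 0ℚ) s))
          (∣survive∣≤survive n K {λ _ → 0ℚ} {barrier n C K}
            (λ s′≤n → ≤-trans (0≤p*q 0≤C (0≤quartic-level n K)) (quartic≤barrier n 0≤C K s′≤n)) s≤n)
        -- At s = n the martingale property says that f k equals g k n, so the growth bound on `g`
        -- also controls `f`.
        f≡g : ∀ k → f k ≡ g k n
        f≡g k = step-elim n n (λ S → S (f k) (g (suc k)) ≡ g k n → f k ≡ g k n)
          (λ _ → id) (λ n≢n → contradiction refl n≢n) (m k ℕ.≤-refl)
        ∣f∣≤quartic : ∀ k → ∣ f k ∣ ≤ C * quartic (level n k)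
        ∣f∣≤quartic k = begin
          ∣ f k ∣                    ≡⟨ cong ∣_∣ (f≡g k) ⟩
          ∣ g k n ∣                  ≡⟨ *-identityˡ _ ⟨
          1ℚ * ∣ g k n ∣             ≤⟨ *-monoʳ-≤-nonNeg ∣ g k n ∣ {{∣-∣-nonNeg (g k n)}} (1≤1+k n k) ⟩
          ℕ→ℚ (suc k) * ∣ g k n ∣    ≤⟨ growth⇒quartic γ k ℕ.≤-refl ⟩
          C * quartic (level n k)    ∎

    growth-1 : Growth 3 (λ _ _ → 1ℚ)
    growth-1 = growth-weaken (growth-weaken (growth-weaken (growth-state (λ _ → 1ℚ))))

    martingale-1 : Martingale n (λ _ → 1ℚ) (λ _ _ → 1ℚ)
    martingale-1 k {s} _ = step-elim n s (λ S → S 1ℚ (λ _ → 1ℚ) ≡ 1ℚ) (λ _ → refl) (λ _ → refl)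

    -- For the constant martingale 1 the survivors' contribution is the survival probability; as it
    -- tends to 0, the game ends almost surely.
    turns-sumsTo-1 : ∀ {s} → s ℕ.≤ n → SumsTo (turns ½ n s) 1ℚ
    turns-sumsTo-1 s≤n ε 0<ε =
      let N , close = martingale⇒SumsTo martingale-1 growth-1 s≤n ε 0<ε in N , λ K N≤K →
        subst (λ v → ∣ v - 1ℚ ∣ < ε)
        (partialSum-cong (λ k → *-identityˡ _) K) (close K N≤K)

    martingale⇒HasExpectation : ∀ {f g} → Martingale n f g → Growth 3 g →
                                ∀ {s} → s ℕ.≤ n → HasExpectation (turns ½ n s) f (g 0 s)
    martingale⇒HasExpectation m γ s≤n = record
      { total      = turns-sumsTo-1 s≤n
      ; integrable = martingale⇒integrable m γ s≤n
      ; value      = martingale⇒SumsTo m γ s≤n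
      }

  -- Transfer of integer expressions to the rationals.

  -- i ↦ q is built along the syntax of an integer expression i, so that q mirrors it in ℚ.
  infix 4 _↦_
  record _↦_ (i : ℤ) (q : ℚ) : Set where
    constructor cast
    field i/1≡q : i / 1 ≡ q

  infixl 6 _⊕_ _⊖_
  infixl 7 _⊗_
  infixr 8 _↑_

  ⟨_⟩ : ∀ i → i ↦ i / 1
  ⟨ i ⟩ = cast refl

  _⊕_ : ∀ {i j p q} → i ↦ p → j ↦ q → i ℤ.+ j ↦ p + q
  _⊕_ {i} {j} (cast refl) (cast refl) = cast (/1-homo-+ i j)

  _⊖_ : ∀ {i j p q} → i ↦ p → j ↦ q → i ℤ.- j ↦ p - q
  _⊖_ {i} {j} (cast refl) (cast refl) = cast (/1-homo-- i j)

  _⊗_ : ∀ {i j p q} → i ↦ p → j ↦ q → i ℤ.* j ↦ p * q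
  _⊗_ {i} {j} (cast refl) (cast refl) = cast (/1-homo-* i j)

  _↑_ : ∀ {i p} → i ↦ p → ∀ r → i ℤ.^ r ↦ p ^ℚ r
  _↑_ {i} (cast refl) r = cast (/1-homo-^ i r)

  ↦-/ : ∀ {i p} d .{{_ : ℕ.NonZero d}} → i ↦ p → i / d ≡ p * (+ 1 / d)
  ↦-/ {i} d (cast refl) = i/d≡i/1*1/d i d

  -- The polynomial martingales of the first three moments.

  2ℚ 3ℚ 8ℚ 16ℚ 32ℚ ⅓ 1/15ℚ : ℚ
  2ℚ    = + 2 / 1
  3ℚ    = + 3 / 1
  8ℚ    = + 8 / 1
  16ℚ   = + 16 / 1
  32ℚ   = + 32 / 1
  ⅓     = + 1 / 3
  1/15ℚ = + 1 / 15

  -- A turn changes t by ±(2s+1), whose square is 4u + 1. Accordingly `φ₂` is the polynomial with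
  -- value 0 at 0 whose average grows by 4u + 1 in a turn. The correlation of t with `φ₂` then
  -- requires the average of `φ₃` to grow by (4u + 1)(4u + 3).
  φ₂ φ₃ : ℚ → ℚ
  φ₂ u = (2ℚ * u * u - u) * ⅓
  φ₃ u = (16ℚ * u * u * u - 8ℚ * u * u - 3ℚ * u) * 1/15ℚ

  :φ₂ :φ₃ : ∀ {m} → Polynomial m → Polynomial m
  :φ₂ u = (con 2ℚ :* u :* u :- u) :* con ⅓
  :φ₃ u = (con 16ℚ :* u :* u :* u :- con 8ℚ :* u :* u :- con 3ℚ :* u) :* con 1/15ℚ

  -- The centre `μ` is a free parameter: the martingale identities hold for each of its values, and
  -- the mean is substituted only at time 0.
  centred : ℚ → ℚ → ℚ → ℚ → ℚ
  centred a μ κ u = κ + (a - u) - μ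

  -- E[X], E[(X-μ)²] and E[(X-μ)³] given that after κ turns there are s < n chips,
  -- where u = s(s+1) and a = n(n+1): the three moments of the remaining time
  -- about its mean a - u are 0, φ₂ a - φ₂ u and φ₃ a - φ₃ u.
  moment₁ : ℚ → ℚ → ℚ → ℚ
  moment₁ a κ u = κ + (a - u)

  moment₂ moment₃ : ℚ → ℚ → ℚ → ℚ → ℚ
  moment₂ a μ κ u = let t = centred a μ κ u in t * t + (φ₂ a - φ₂ u)
  moment₃ a μ κ u = let t = centred a μ κ u in
    t * t * t + 3ℚ * t * (φ₂ a - φ₂ u) + (φ₃ a - φ₃ u)

  :moment₁ : ∀ {m} → Polynomial m → Polynomial m → Polynomial m → Polynomial m
  :moment₁ a κ u = κ :+ (a :- u)

  :moment₂ :moment₃ : ∀ {m} → Polynomial m → Polynomial m → Polynomial m → Polynomial m → Polynomial m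
  :moment₂ a μ κ u = let t = κ :+ (a :- u) :- μ in t :* t :+ (:φ₂ a :- :φ₂ u)
  :moment₃ a μ κ u = let t = κ :+ (a :- u) :- μ in
    t :* t :* t :+ con 3ℚ :* t :* (:φ₂ a :- :φ₂ u) :+ (:φ₃ a :- :φ₃ u)

  -- Space-time harmonicity in the variables κ and x(x+1). Letting x range over all rationals turns
  -- it into a polynomial identity within reach of the ring solver.
  Harmonic : (ℚ → ℚ → ℚ) → Set
  Harmonic G = ∀ κ x →
    ½ * G (1ℚ + κ) ((1ℚ + x) * (1ℚ + (1ℚ + x))) + ½ * G (1ℚ + κ) ((x - 1ℚ) * x)
    ≡ G κ (x * (1ℚ + x))

  :harmonic : ∀ {m} → (Polynomial m → Polynomial m → Polynomial m) →
              Polynomial m → Polynomial m → Polynomial m × Polynomial m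
  :harmonic G κ x = let i = con 1ℚ in
    con ½ :* G (i :+ κ) ((i :+ x) :* (i :+ (i :+ x))) :+ con ½ :* G (i :+ κ) ((x :- i) :* x)
    := G κ (x :* (i :+ x))

  moment₁-harmonic : ∀ a → Harmonic (moment₁ a)
  moment₁-harmonic = solve 3 (λ a κ x → :harmonic (:moment₁ a) κ x) refl

  moment₂-harmonic : ∀ a μ → Harmonic (moment₂ a μ)
  moment₂-harmonic = solve 4 (λ a μ κ x → :harmonic (:moment₂ a μ) κ x) refl

  moment₃-harmonic : ∀ a μ → Harmonic (moment₃ a μ)
  moment₃-harmonic = solve 4 (λ a μ κ x → :harmonic (:moment₃ a μ) κ x) refl

  moment₂-terminal : ∀ a μ κ → (κ - μ) ^ℚ 2 ≡ moment₂ a μ κ a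
  moment₂-terminal = solve 3 (λ a μ κ → (κ :- μ) :^ 2 := :moment₂ a μ κ a) refl

  moment₃-terminal : ∀ a μ κ → (κ - μ) ^ℚ 3 ≡ moment₃ a μ κ a
  moment₃-terminal = solve 3 (λ a μ κ → (κ :- μ) :^ 3 := :moment₃ a μ κ a) refl

  -- With the mean as centre, t = 0 at the start, so only φ₂(a) - φ₂(u) remains; it is divisible by
  -- a - u = (y - x)(y + x + 1).
  moment₂-initial : ∀ y x → let a = y * (1ℚ + y); u = x * (1ℚ + x) in
    moment₂ a (moment₁ a 0ℚ u) 0ℚ u
    ≡ (y - x) * (y + x + 1ℚ)
      * (2ℚ * y ^ℚ 2 + 2ℚ * y + 2ℚ * x ^ℚ 2 + 2ℚ * x - 1ℚ) * ⅓
  moment₂-initial = solve 2 (λ y x →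
    let 1# = con 1ℚ; 2# = con 2ℚ; a = y :* (1# :+ y); u = x :* (1# :+ x) in
    :moment₂ a (:moment₁ a (con 0ℚ) u) (con 0ℚ) u
    := (y :- x) :* (y :+ x :+ 1#)
       :* (2# :* y :^ 2 :+ 2# :* y :+ 2# :* x :^ 2 :+ 2# :* x :- 1#) :* con ⅓) refl

  moment₃-initial : ∀ y x → let a = y * (1ℚ + y); u = x * (1ℚ + x) in
    moment₃ a (moment₁ a 0ℚ u) 0ℚ u
    ≡ (y - x) * (y + x + 1ℚ)
      * (16ℚ * y ^ℚ 4 + 32ℚ * y ^ℚ 3
         + 8ℚ * y ^ℚ 2 * (2ℚ * x ^ℚ 2 + 2ℚ * x + 1ℚ)
         + 8ℚ * y * (2ℚ * x ^ℚ 2 + 2ℚ * x - 1ℚ)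
         + 16ℚ * x ^ℚ 4 + 32ℚ * x ^ℚ 3 + 8ℚ * x ^ℚ 2 - 8ℚ * x - 3ℚ) * 1/15ℚ
  moment₃-initial = solve 2 (λ y x →
    let 1# = con 1ℚ; 2# = con 2ℚ; 8# = con 8ℚ; a = y :* (1# :+ y); u = x :* (1# :+ x) in
    :moment₃ a (:moment₁ a (con 0ℚ) u) (con 0ℚ) u
    := (y :- x) :* (y :+ x :+ 1#)
       :* (con 16ℚ :* y :^ 4 :+ con 32ℚ :* y :^ 3
           :+ 8# :* y :^ 2 :* (2# :* x :^ 2 :+ 2# :* x :+ 1#)
           :+ 8# :* y :* (2# :* x :^ 2 :+ 2# :* x :- 1#)
           :+ con 16ℚ :* x :^ 4 :+ con 32ℚ :* x :^ 3 :+ 8# :* x :^ 2 :- 8# :* x :- con 3ℚ)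
       :* con 1/15ℚ) refl

  -- The moments of the number of turns.

  module _ (n : ℕ) where

    harmonic⇒martingale : ∀ {f} (G : ℚ → ℚ → ℚ) → Harmonic G →
      (∀ k → f k ≡ G (ℕ→ℚ k) (oblong n)) → Martingale n f (λ k s → G (ℕ→ℚ k) (oblong s))
    harmonic⇒martingale {f} G harmonic terminal k {s} _ =
      step-elim n s (λ S → S (f k) (λ s′ → G (ℕ→ℚ (suc k)) (oblong s′)) ≡ G (ℕ→ℚ k) (oblong s))
        (λ s≡n → trans (terminal k) (cong (λ t → G (ℕ→ℚ k) (oblong t)) (sym s≡n)))
        λ _ → begin
      avg (λ s′ → G (ℕ→ℚ (suc k)) (oblong s′)) s
        ≡⟨ cong (λ κ → avg (λ s′ → G κ (oblong s′)) s) (ℕ→ℚ-suc k) ⟩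
      avg (λ s′ → G (1ℚ + ℕ→ℚ k) (oblong s′)) s
        ≡⟨ avg-oblong (G (1ℚ + ℕ→ℚ k)) s ⟩
      _
        ≡⟨ harmonic (ℕ→ℚ k) (ℕ→ℚ s) ⟩
      G (ℕ→ℚ k) (oblong s) ∎
      where open ≡-Reasoning

    growth-moment₁ : Growth n 1 (λ k s → moment₁ (oblong n) (ℕ→ℚ k) (oblong s))
    growth-moment₁ = growth-+ n (growth-time n)
      (growth-weaken n (growth-state n (λ s → oblong n - oblong s)))

    growth-centred : ∀ μ → Growth n 1 (λ k s → centred (oblong n) μ (ℕ→ℚ k) (oblong s))
    growth-centred μ = growth-+ n growth-moment₁ (growth-weaken n (growth-state n (λ _ → - μ)))

    growth-moment₂ : ∀ μ → Growth n 2 (λ k s → moment₂ (oblong n) μ (ℕ→ℚ k) (oblong s))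
    growth-moment₂ μ = growth-+ n (growth-* n (growth-centred μ) (growth-centred μ))
      (growth-weaken n (growth-weaken n (growth-state n (λ s → φ₂ (oblong n) - φ₂ (oblong s)))))

    growth-moment₃ : ∀ μ → Growth n 3 (λ k s → moment₃ (oblong n) μ (ℕ→ℚ k) (oblong s))
    growth-moment₃ μ = growth-+ n
      (growth-+ n (growth-* n (growth-* n (growth-centred μ) (growth-centred μ)) (growth-centred μ))
        -- The mixed term has degree 0 + 1 + 0, two short of 3.
        (growth-weaken n (growth-weaken n
          (growth-* n (growth-* n (growth-state n (λ _ → 3ℚ)) (growth-centred μ))
            (growth-state n (λ s → φ₂ (oblong n) - φ₂ (oblong s)))))))
      (growth-weaken n (growth-weaken n (growth-weaken n
        (growth-state n (λ s → φ₃ (oblong n) - φ₃ (oblong s))))))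

    mean : ℕ → ℚ
    mean s = moment₁ (oblong n) 0ℚ (oblong s)

    hasMean : ∀ {s} → s ℕ.≤ n → HasMean (turns ½ n s) (mean s)
    hasMean s≤n = martingale⇒HasExpectation n
      (harmonic⇒martingale (moment₁ (oblong n)) (moment₁-harmonic (oblong n)) λ k →
        solve 2 (λ κ a → κ := κ :+ (a :- a)) refl (ℕ→ℚ k) (oblong n))
      (growth-weaken n (growth-weaken n growth-moment₁)) s≤n

    hasMoment₂ : ∀ {s} → s ℕ.≤ n → ∀ μ →
      HasMomentAbout μ 2 (turns ½ n s) (moment₂ (oblong n) μ 0ℚ (oblong s))
    hasMoment₂ s≤n μ = martingale⇒HasExpectation n
      (harmonic⇒martingale (moment₂ (oblong n) μ) (moment₂-harmonic (oblong n) μ)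
        (λ k → moment₂-terminal (oblong n) μ (ℕ→ℚ k)))
      (growth-weaken n (growth-moment₂ μ)) s≤n

    hasMoment₃ : ∀ {s} → s ℕ.≤ n → ∀ μ →
      HasMomentAbout μ 3 (turns ½ n s) (moment₃ (oblong n) μ 0ℚ (oblong s))
    hasMoment₃ s≤n μ = martingale⇒HasExpectation n
      (harmonic⇒martingale (moment₃ (oblong n) μ) (moment₃-harmonic (oblong n) μ)
        (λ k → moment₃-terminal (oblong n) μ (ℕ→ℚ k)))
      (growth-moment₃ μ) s≤n

open import Data.Integer using (+_; _+_; _-_; _*_; _^_)
open import Data.Nat using (ℕ; _≤_)
open import Data.Product using (∃; _×_; _,_)
open import Data.Rational using (½; _/_)
open import Relation.Binary.PropositionalEquality using (subst; sym; trans)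

proposition6 : ∀ (n s : ℕ) → s ≤ n →
    let P = turns ½ n s
        N = + n
        S = + s
    in ∃ λ μ →
      HasMean P μ
      × HasMomentAbout μ 2 P
          (((N - S) * (N + S + + 1)
            * (+ 2 * N ^ 2 + + 2 * N + + 2 * S ^ 2 + + 2 * S - + 1)) / 3)
      × HasMomentAbout μ 3 P
          (((N - S) * (N + S + + 1)
            * (+ 16 * N ^ 4 + + 32 * N ^ 3
               + + 8 * N ^ 2 * (+ 2 * S ^ 2 + + 2 * S + + 1)
               + + 8 * N * (+ 2 * S ^ 2 + + 2 * S - + 1)
               + + 16 * S ^ 4 + + 32 * S ^ 3 + + 8 * S ^ 2 - + 8 * S - + 3)) / 15)
proposition6 n s s≤n = mean n s , hasMean n s≤n
  , subst (HasMomentAbout (mean n s) 2 (turns ½ n s))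
      -- The expression given to `↦-/` repeats the integer numerator of the claim, and its rational
      -- mirror is the right side of `moment₂-initial` before the factor `⅓`.
      (trans (moment₂-initial (ℕ→ℚ n) (ℕ→ℚ s)) (sym (↦-/ 3
        ((N ⊖ S) ⊗ (N ⊕ S ⊕ ⟨ + 1 ⟩)
          ⊗ (⟨ + 2 ⟩ ⊗ N ↑ 2 ⊕ ⟨ + 2 ⟩ ⊗ N ⊕ ⟨ + 2 ⟩ ⊗ S ↑ 2 ⊕ ⟨ + 2 ⟩ ⊗ S ⊖ ⟨ + 1 ⟩)))))
      (hasMoment₂ n s≤n (mean n s))
  , subst (HasMomentAbout (mean n s) 3 (turns ½ n s))
      (trans (moment₃-initial (ℕ→ℚ n) (ℕ→ℚ s)) (sym (↦-/ 15
        ((N ⊖ S) ⊗ (N ⊕ S ⊕ ⟨ + 1 ⟩)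
          ⊗ (⟨ + 16 ⟩ ⊗ N ↑ 4 ⊕ ⟨ + 32 ⟩ ⊗ N ↑ 3
             ⊕ ⟨ + 8 ⟩ ⊗ N ↑ 2 ⊗ (⟨ + 2 ⟩ ⊗ S ↑ 2 ⊕ ⟨ + 2 ⟩ ⊗ S ⊕ ⟨ + 1 ⟩)
             ⊕ ⟨ + 8 ⟩ ⊗ N ⊗ (⟨ + 2 ⟩ ⊗ S ↑ 2 ⊕ ⟨ + 2 ⟩ ⊗ S ⊖ ⟨ + 1 ⟩)
             ⊕ ⟨ + 16 ⟩ ⊗ S ↑ 4 ⊕ ⟨ + 32 ⟩ ⊗ S ↑ 3 ⊕ ⟨ + 8 ⟩ ⊗ S ↑ 2 ⊖ ⟨ + 8 ⟩ ⊗ S ⊖ ⟨ + 3 ⟩)))))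
      (hasMoment₃ n s≤n (mean n s))
  where
  N = ⟨ + n ⟩
  S = ⟨ + s ⟩
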